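{- Let $G=A_5\times\mathbb Z_2=A_5\times\langle a\rangle$ with $|a|=2$, and let $r_0,r_1,r_2\in G$ be involutions with $G=\langle r_0,r_1,r_2\rangle$ such that $\mathcal M(G;r_0,r_1,r_2)$ is a regular linear hypermap; put $H=\langle r_1,r_2\rangle$, $K=\langle r_0,r_2\rangle$. Then $\mathcal M(G;r_0,r_1,r_2)$ is isomorphic to one of the following: $\mathcal M_1=\mathcal M(G;(12)(35),(12)(34)a,(14)(23))$; $\mathcal M_2=\mathcal M(G;(12)(35),(13)(24)a,(14)(23))$; $\mathcal M_3=\mathcal M(G;(12)(35)a,(12)(34)a,(13)(24)a)$; $\mathcal M_4=\mathcal M(G;(12)(35)a,(13)(24)a,(12)(34)a)$; $\mathcal M_5=\mathcal M(G;(12)(35)a,(14)(23),(12)(34)a)$; $\mathcal M_6=\mathcal M(G;(14)(25)a,(12)(34)a,(13)(24)a)$; $\mathcal M_7=\mathcal M(G;(12)(35)a,(14)(23),(13)(24)a)$; $\mathcal M_8=\mathcal M(G;(14)(25),(12)(34)a,(14)(23))$; $\mathcal M_9=\mathcal M(G;(14)(25)a,(14)(23),(12)(34)a)$; $\mathcal M_{10}=\mathcal M(G;(14)(35)a,(12)(45),(13)(45))$; $\mathcal M_{11}=\mathcal M(G;(14)(35)a,(12)(45)a,(13)(45)a)$; $\mathcal M_{12}=\mathcal M(G;(13)(24)a,(12)(45)a,(13)(45)a)$; $\mathcal M_{13}=\mathcal M(G;(14)(35),(12)(45)a,(13)(45)a)$; $\mathcal M_{14}=\mathcal M(G;(14)(35)a,(14)(23),(13)(45))$;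 $\mathcal M_{15}=\mathcal M(G;(15)(34)a,(14)(23),(13)(45))$; $\mathcal M_{16}=\mathcal M(G;(14)(35)a,(14)(23)a,(13)(45)a)$; $\mathcal M_{17}=\mathcal M(G;(15)(34)a,(14)(23)a,(13)(45)a)$; $\mathcal M_{18}=\mathcal M(G;(14)(35),(14)(23)a,(13)(45)a)$; $\mathcal M_{19}=\mathcal M(G;(15)(34),(14)(23)a,(13)(45)a)$. Moreover, the linear hypermaps $\mathcal M_1,\dots,\mathcal M_{19}$ are pairwise non-isomorphic.
   Context: $A_5$ acts on $\{1,2,3,4,5\}$ and its elements are written as products of disjoint cycles; $a$ is the generator of the direct factor $\mathbb Z_2$. Let $G$ be a finite group and $r_0,r_1,r_2\in G$ pairwise distinct involutions with $G=\langle r_0,r_1,r_2\rangle$. $\mathcal M(G;r_0,r_1,r_2)$ is a regular linear hypermap if (1) $\langle r_1,r_2\rangle\cap\langle r_0,r_2\rangle=\langle r_2\rangle$ and (2) $\langle r_1,r_2\rangle\langle r_0,r_2\rangle\cap\langle r_0,r_2\rangle\langle r_1,r_2\rangle=\langle r_1,r_2\rangle\cup\langle r_0,r_2\rangle$ (products of subsets). Its flags are the elements of $G$ with $r_i$ acting by right multiplication. Two such hypermaps $\mathcal M(G;r_i)$ and $\mathcal M(G';s_i)$ are isomorphic if there is a bijection $\sigma:G\to G'$ with $(xr_i)^\sigma=x^\sigma s_i$ for all $x\in G$, $i=0,1,2$. -}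

module Defs where

open import Data.Bool using (Bool; true; false; if_then_else_; _xor_; _∧_; T; not)
open import Data.Nat using (ℕ; zero; suc; _+_; _<ᵇ_)
open import Data.Fin using (Fin; zero; suc; toℕ; #_)
open import Data.Fin.Properties using (_≟_)
open import Data.Vec using (Vec; []; _∷_; lookup; tabulate)
open import Data.List using (List; []; _∷_; map; concatMap; allFin)
open import Data.Bool.ListAction using (and)
open import Data.Nat.ListAction using (sum)
open import Data.List.Membership.Propositional using (_∈_)
open import Data.Product using (Σ; ∃; _×_; _,_)
open import Data.Sum using (_⊎_)
open import Relation.Nullary using (¬_; does)
open import Relation.Binary.PropositionalEquality using (_≡_; _≢_)

-- The ambient set: Elem = (maps of {1..5}, as image vectors) × Z₂.
-- A map p is stored as the vector (p(1),…,p(5)) (points 1..5 are Fin 5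
-- indices 0..4).  The Bool component is the Z₂ = ⟨a⟩ coordinate
-- (true = a).

Perm5 : Set
Perm5 = Vec (Fin 5) 5

Elem : Set
Elem = Perm5 × Bool

p1 p2 p3 p4 p5 : Fin 5
p1 = # 0
p2 = # 1
p3 = # 2
p4 = # 3
p5 = # 4

-- multiplication: x · y = "first x, then y" (composition of maps), xor on Z₂
_·_ : Elem → Elem → Elem
(p , s) · (q , t) = tabulate (λ k → lookup q (lookup p k)) , (s xor t)

infixl 7 _·_

e : Elem
e = tabulate (λ k → k) , false

pairs : List (Fin 5 × Fin 5)
pairs = concatMap (λ i → concatMap (λ j → if toℕ i <ᵇ toℕ j then (i , j) ∷ [] else []) (allFin 5)) (allFin 5)

isPermᵇ : Perm5 → Bool
isPermᵇ p = and (map (λ ij → not (does (lookup p (Data.Product.proj₁ ij) ≟ lookup p (Data.Product.proj₂ ij)))) pairs)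

inversions : Perm5 → ℕ
inversions p = sum (map (λ ij → if toℕ (lookup p (Data.Product.proj₂ ij)) <ᵇ toℕ (lookup p (Data.Product.proj₁ ij)) then 1 else 0) pairs)

evenᵇ : ℕ → Bool
evenᵇ zero = true
evenᵇ (suc n) = not (evenᵇ n)

inA5ᵇ : Perm5 → Bool
inA5ᵇ p = isPermᵇ p ∧ evenᵇ (inversions p)

InG : Elem → Set
InG (p , _) = T (inA5ᵇ p)

Involution : Elem → Set
Involution x = x ≢ e × x · x ≡ e

-- subgroup generated by a list of elements (in a finite group the
-- generated submonoid is the generated subgroup)
data ⟨_⟩ (S : List Elem) : Elem → Set where
  one : ⟨ S ⟩ e
  gen : ∀ {x} → x ∈ S → ⟨ S ⟩ x
  mul : ∀ {x y} → ⟨ S ⟩ x → ⟨ S ⟩ y → ⟨ S ⟩ (x · y)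

_⋆_ : (Elem → Set) → (Elem → Set) → Elem → Set
(A ⋆ B) x = Σ Elem λ a → Σ Elem λ b → A a × B b × x ≡ a · b

record Triple : Set where
  constructor mkT
  field
    r₀ r₁ r₂ : Elem
open Triple public

r : Triple → Fin 3 → Elem
r t zero = r₀ t
r t (suc zero) = r₁ t
r t (suc (suc zero)) = r₂ t

RegularLinearHypermap : Triple → Set
RegularLinearHypermap t =
  (∀ i → InG (r t i)) ×
  (∀ i → Involution (r t i)) ×
  (r₀ t ≢ r₁ t × r₀ t ≢ r₂ t × r₁ t ≢ r₂ t) ×
  (∀ x → InG x → ⟨ r₀ t ∷ r₁ t ∷ r₂ t ∷ [] ⟩ x) ×
  (∀ x → (H x × K x → ⟨ r₂ t ∷ [] ⟩ x) × (⟨ r₂ t ∷ [] ⟩ x → H x × K x)) ×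
  (∀ x → ((H ⋆ K) x × (K ⋆ H) x → H x ⊎ K x) × (H x ⊎ K x → (H ⋆ K) x × (K ⋆ H) x))
  where
  H K : Elem → Set
  H = ⟨ r₁ t ∷ r₂ t ∷ [] ⟩
  K = ⟨ r₀ t ∷ r₂ t ∷ [] ⟩

-- isomorphism of hypermaps on the flag set G: a bijection σ : G → G
-- with (x r_i)^σ = x^σ s_i.  σ is given as a map on Elem that restricts
-- to a bijection of the subset G.
record HypermapIso (t s : Triple) : Set where
  field
    σ : Elem → Elem
    σ-G : ∀ x → InG x → InG (σ x)
    σ-inj : ∀ x y → InG x → InG y → σ x ≡ σ y → x ≡ y
    σ-surj : ∀ y → InG y → Σ Elem λ x → InG x × σ x ≡ y
    σ-comm : ∀ i x → InG x → σ (x · r t i) ≡ σ x · r s i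

dt : Fin 5 → Fin 5 → Fin 5 → Fin 5 → Perm5
dt a b c d = tabulate λ k →
  if does (k ≟ a) then b else
  if does (k ≟ b) then a else
  if does (k ≟ c) then d else
  if does (k ≟ d) then c else k

_⦅_⦆_⦅_⦆ : Fin 5 → Fin 5 → Fin 5 → Fin 5 → Elem
a ⦅ b ⦆ c ⦅ d ⦆ = dt a b c d , false

_⦅_⦆_⦅_⦆a : Fin 5 → Fin 5 → Fin 5 → Fin 5 → Elem
a ⦅ b ⦆ c ⦅ d ⦆a = dt a b c d , true

-- the nineteen hypermaps M₁ … M₁₉ (index i : Fin 19 stands for M_{i+1})
Ms : Vec Triple 19
Ms =
    mkT (p1 ⦅ p2 ⦆ p3 ⦅ p5 ⦆)  (p1 ⦅ p2 ⦆ p3 ⦅ p4 ⦆a) (p1 ⦅ p4 ⦆ p2 ⦅ p3 ⦆)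
  ∷ mkT (p1 ⦅ p2 ⦆ p3 ⦅ p5 ⦆)  (p1 ⦅ p3 ⦆ p2 ⦅ p4 ⦆a) (p1 ⦅ p4 ⦆ p2 ⦅ p3 ⦆)
  ∷ mkT (p1 ⦅ p2 ⦆ p3 ⦅ p5 ⦆a) (p1 ⦅ p2 ⦆ p3 ⦅ p4 ⦆a) (p1 ⦅ p3 ⦆ p2 ⦅ p4 ⦆a)
  ∷ mkT (p1 ⦅ p2 ⦆ p3 ⦅ p5 ⦆a) (p1 ⦅ p3 ⦆ p2 ⦅ p4 ⦆a) (p1 ⦅ p2 ⦆ p3 ⦅ p4 ⦆a)
  ∷ mkT (p1 ⦅ p2 ⦆ p3 ⦅ p5 ⦆a) (p1 ⦅ p4 ⦆ p2 ⦅ p3 ⦆)  (p1 ⦅ p2 ⦆ p3 ⦅ p4 ⦆a)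
  ∷ mkT (p1 ⦅ p4 ⦆ p2 ⦅ p5 ⦆a) (p1 ⦅ p2 ⦆ p3 ⦅ p4 ⦆a) (p1 ⦅ p3 ⦆ p2 ⦅ p4 ⦆a)
  ∷ mkT (p1 ⦅ p2 ⦆ p3 ⦅ p5 ⦆a) (p1 ⦅ p4 ⦆ p2 ⦅ p3 ⦆)  (p1 ⦅ p3 ⦆ p2 ⦅ p4 ⦆a)
  ∷ mkT (p1 ⦅ p4 ⦆ p2 ⦅ p5 ⦆)  (p1 ⦅ p2 ⦆ p3 ⦅ p4 ⦆a) (p1 ⦅ p4 ⦆ p2 ⦅ p3 ⦆)
  ∷ mkT (p1 ⦅ p4 ⦆ p2 ⦅ p5 ⦆a) (p1 ⦅ p4 ⦆ p2 ⦅ p3 ⦆)  (p1 ⦅ p2 ⦆ p3 ⦅ p4 ⦆a)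
  ∷ mkT (p1 ⦅ p4 ⦆ p3 ⦅ p5 ⦆a) (p1 ⦅ p2 ⦆ p4 ⦅ p5 ⦆)  (p1 ⦅ p3 ⦆ p4 ⦅ p5 ⦆)
  ∷ mkT (p1 ⦅ p4 ⦆ p3 ⦅ p5 ⦆a) (p1 ⦅ p2 ⦆ p4 ⦅ p5 ⦆a) (p1 ⦅ p3 ⦆ p4 ⦅ p5 ⦆a)
  ∷ mkT (p1 ⦅ p3 ⦆ p2 ⦅ p4 ⦆a) (p1 ⦅ p2 ⦆ p4 ⦅ p5 ⦆a) (p1 ⦅ p3 ⦆ p4 ⦅ p5 ⦆a)
  ∷ mkT (p1 ⦅ p4 ⦆ p3 ⦅ p5 ⦆)  (p1 ⦅ p2 ⦆ p4 ⦅ p5 ⦆a) (p1 ⦅ p3 ⦆ p4 ⦅ p5 ⦆a)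
  ∷ mkT (p1 ⦅ p4 ⦆ p3 ⦅ p5 ⦆a) (p1 ⦅ p4 ⦆ p2 ⦅ p3 ⦆)  (p1 ⦅ p3 ⦆ p4 ⦅ p5 ⦆)
  ∷ mkT (p1 ⦅ p5 ⦆ p3 ⦅ p4 ⦆a) (p1 ⦅ p4 ⦆ p2 ⦅ p3 ⦆)  (p1 ⦅ p3 ⦆ p4 ⦅ p5 ⦆)
  ∷ mkT (p1 ⦅ p4 ⦆ p3 ⦅ p5 ⦆a) (p1 ⦅ p4 ⦆ p2 ⦅ p3 ⦆a) (p1 ⦅ p3 ⦆ p4 ⦅ p5 ⦆a)
  ∷ mkT (p1 ⦅ p5 ⦆ p3 ⦅ p4 ⦆a) (p1 ⦅ p4 ⦆ p2 ⦅ p3 ⦆a) (p1 ⦅ p3 ⦆ p4 ⦅ p5 ⦆a)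
  ∷ mkT (p1 ⦅ p4 ⦆ p3 ⦅ p5 ⦆)  (p1 ⦅ p4 ⦆ p2 ⦅ p3 ⦆a) (p1 ⦅ p3 ⦆ p4 ⦅ p5 ⦆a)
  ∷ mkT (p1 ⦅ p5 ⦆ p3 ⦅ p4 ⦆)  (p1 ⦅ p4 ⦆ p2 ⦅ p3 ⦆a) (p1 ⦅ p3 ⦆ p4 ⦅ p5 ⦆a)
  ∷ []

M : Fin 19 → Triple
M i = lookup Ms i

{-# OPTIONS --safe #-}
module Submission where

-- Conditions (1) and (2) forbid any coincidence h·k = k′·h′ with h, h′ ∈ H, k, k′ ∈ K and h, k outside ⟨r₂⟩.
-- Relabelling the five points is an isomorphism of hypermaps, so r₁ may be assumed to be one of (12)(34),
-- (12)(34)a and a. For each remaining choice of r₀ and r₂ either alternating words exhibit a forbidden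
-- coincidence, or some relabelling carries the triple to one of the models, or the triple generates a proper
-- subgroup. The models are told apart by the relators they satisfy, which an isomorphism preserves and
-- reflects because it intertwines the two right actions.

open import Defs
open import Data.Bool using (Bool; true; false; T)
open import Data.Bool.ListAction using (all)
import Data.Bool.Properties as Bool
open import Data.Fin using (Fin; zero; suc; #_)
import Data.Fin.Properties as Fin
open import Data.List using (List; []; _∷_; _++_; map; filter; concat; replicate; allFin; cartesianProduct; cartesianProductWith)
import Data.List.Properties as List
open import Data.List.Membership.Propositional using (_∈_; _∉_; find)
open import Data.List.Membership.Propositional.Properties using (∈-allFin; ∈-filter⁺; ∈-filter⁻; ∈-cartesianProduct⁺; ∈-cartesianProduct⁻; ∈-cartesianProductWith⁺)
open import Data.List.Relation.Unary.All using (All; []; _∷_; all?)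
import Data.List.Relation.Unary.All as All
import Data.List.Relation.Unary.All.Properties as All
open import Data.List.Relation.Unary.Any using (Any; here; there; any?)
open import Data.Nat using (ℕ; zero; suc)
open import Data.Product using (Σ; ∃; _×_; _,_; proj₁; proj₂)
open import Data.Product.Properties using (≡-dec)
open import Data.Sum as Sum using (_⊎_; inj₁; inj₂; [_,_]′)
open import Data.Vec using (Vec; []; _∷_; lookup)
import Data.Vec.Properties as Vec
open import Function using (_∘_; id; mk⇔; Equivalence)
open import Relation.Nullary using (¬_; Dec; yes; does; contradiction)
open import Relation.Nullary.Decidable using (T?; _×-dec_; _⊎-dec_; _→-dec_; ¬?; map′; does-⇔)
open import Relation.Binary.Definitions using (DecidableEquality)
open import Relation.Binary.PropositionalEquality using (_≡_; _≢_; refl; sym; trans; cong; cong₂; subst; module ≡-Reasoning)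
open ≡-Reasoning

-- Decidable equality and the monoid laws of `Elem`.

infix 4 _≟_

_≟_ : DecidableEquality Elem
_≟_ = ≡-dec (Vec.≡-dec Fin._≟_) Bool._≟_

open import Data.List.Membership.DecPropositional _≟_ using (_∈?_)

-- The premise speaks of `does` alone, so a check by `refl` evaluates a Boolean and not the proof it
-- stands for.
decided : ∀ {P : Set} (P? : Dec P) → does P? ≡ true → P
decided (yes p) _ = p

·-assoc : ∀ x y z → (x · y) · z ≡ x · (y · z)
·-assoc (p , s) (q , t) (u , v) = cong₂ _,_
  (Vec.tabulate-cong λ k → trans (cong (lookup u) (Vec.lookup∘tabulate (λ k → lookup q (lookup p k)) k))
                                 (sym (Vec.lookup∘tabulate (λ k → lookup u (lookup q k)) (lookup p k))))
  (Bool.xor-assoc s t v)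

·-identityˡ : ∀ x → e · x ≡ x
·-identityˡ (p , s) = cong (_, s)
  (trans (Vec.tabulate-cong λ k → cong (lookup p) (Vec.lookup∘tabulate id k)) (Vec.tabulate∘lookup p))

·-identityʳ : ∀ x → x · e ≡ x
·-identityʳ (p , s) = cong₂ _,_
  (trans (Vec.tabulate-cong λ k → Vec.lookup∘tabulate id (lookup p k)) (Vec.tabulate∘lookup p))
  (Bool.xor-identityʳ s)

cancel-middle : ∀ x {y z} w → y · z ≡ e → (x · y) · (z · w) ≡ x · w
cancel-middle x {y} {z} w yz≡e = begin
  (x · y) · (z · w)  ≡⟨ ·-assoc x y (z · w) ⟩
  x · (y · (z · w))  ≡⟨ cong (x ·_) (·-assoc y z w) ⟨
  x · (y · z · w)    ≡⟨ cong (λ v → x · (v · w)) yz≡e ⟩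
  x · (e · w)        ≡⟨ cong (x ·_) (·-identityˡ w) ⟩
  x · w              ∎

inverse-cancel : ∀ {x x⁻¹} → x⁻¹ · x ≡ e → ∀ y → x⁻¹ · (x · y) ≡ y
inverse-cancel {x} {x⁻¹} x⁻¹x≡e y =
  trans (sym (·-assoc x⁻¹ x y)) (trans (cong (_· y) x⁻¹x≡e) (·-identityˡ y))

inverse-cancelʳ : ∀ {x x⁻¹} → x · x⁻¹ ≡ e → ∀ y → y · x · x⁻¹ ≡ y
inverse-cancelʳ {x} {x⁻¹} xx⁻¹≡e y =
  trans (·-assoc y x x⁻¹) (trans (cong (y ·_) xx⁻¹≡e) (·-identityʳ y))

-- Generated subgroups

-- The induction shows that right multiplication by any element of ⟨S⟩ preserves `P`; a product acts
-- by one factor after the other, so stability under generators suffices. The walk starts at `e`.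
⟨⟩-least : ∀ {S} (P : Elem → Set) → P e → (∀ {x s} → P x → s ∈ S → P (x · s)) → ∀ {x} → ⟨ S ⟩ x → P x
⟨⟩-least {S} P Pe P· {x} Sx = subst P (·-identityˡ x) (go Sx Pe)
  where
  go : ∀ {y z} → ⟨ S ⟩ y → P z → P (z · y)
  go {z = z} one Pz = subst P (sym (·-identityʳ z)) Pz
  go (gen s∈S) Pz = P· Pz s∈S
  go {z = z} (mul {x} {y} Sx Sy) Pz = subst P (·-assoc z x y) (go Sy (go Sx Pz))

⟨⟩-image : ∀ {S S′} (φ : Elem → Elem) → φ e ≡ e → (∀ x y → φ (x · y) ≡ φ x · φ y) →
           All (⟨ S′ ⟩ ∘ φ) S → ∀ {x} → ⟨ S ⟩ x → ⟨ S′ ⟩ (φ x)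
⟨⟩-image {S′ = S′} φ φ-e φ-· φS⊆ = ⟨⟩-least (⟨ S′ ⟩ ∘ φ) (subst ⟨ S′ ⟩ (sym φ-e) one)
  λ {x} {s} φx s∈ → subst ⟨ S′ ⟩ (sym (φ-· x s)) (mul φx (All.lookup φS⊆ s∈))

⟨⟩-mono : ∀ {S S′} → All ⟨ S′ ⟩ S → ∀ {x} → ⟨ S ⟩ x → ⟨ S′ ⟩ x
⟨⟩-mono = ⟨⟩-image id refl (λ _ _ → refl)

-- `⟨_⟩` is only a submonoid by definition. Involutive generators are their own inverses, and a
-- product is inverted by reversing it.
⟨⟩-inverse : ∀ {S} → All (λ s → s · s ≡ e) S → ∀ {x} → ⟨ S ⟩ x → ∃ λ y → ⟨ S ⟩ y × x · y ≡ e × y · x ≡ e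
⟨⟩-inverse inv one = e , one , refl , refl
⟨⟩-inverse inv (gen {x} s) = x , gen s , All.lookup inv s , All.lookup inv s
⟨⟩-inverse inv (mul {x} {y} Sx Sy) with ⟨⟩-inverse inv Sx | ⟨⟩-inverse inv Sy
... | x⁻¹ , Sx⁻¹ , xx⁻¹ , x⁻¹x | y⁻¹ , Sy⁻¹ , yy⁻¹ , y⁻¹y =
  y⁻¹ · x⁻¹ , mul Sy⁻¹ Sx⁻¹ ,
  trans (cancel-middle x {y} {y⁻¹} x⁻¹ yy⁻¹) xx⁻¹ ,
  trans (cancel-middle y⁻¹ {x⁻¹} {x} y x⁻¹x) y⁻¹y

-- A decidable certificate that bounds ⟨S⟩ from above; the search below bounds it from below.
Closed : List Elem → List Elem → Set
Closed S L = e ∈ L × All (λ x → All (λ s → x · s ∈ L) S) L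

closed? : ∀ S L → Dec (Closed S L)
closed? S L = (e ∈? L) ×-dec all? (λ x → all? (λ s → x · s ∈? L) S) L

closed⊇⟨⟩ : ∀ {S L} → Closed S L → ∀ {x} → ⟨ S ⟩ x → x ∈ L
closed⊇⟨⟩ (e∈L , L·S⊆L) = ⟨⟩-least (_∈ _) e∈L λ x∈L → All.lookup (All.lookup L·S⊆L x∈L)

-- visit matches on its first argument, so that a blocked search does not normalise both continuations.
mutual
  explore : ℕ → List Elem → (seen todo : List Elem) → List Elem
  explore zero    S seen todo       = seen
  explore (suc n) S seen []         = seen
  explore (suc n) S seen (x ∷ todo) = visit (does (x ∈? seen)) n S x seen todo

  visit : Bool → ℕ → List Elem → Elem → (seen todo : List Elem) → List Elem
  visit true  n S x seen todo = explore n S seen todo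
  visit false n S x seen todo = explore n S (x ∷ seen) (map (x ·_) S ++ todo)

mutual
  -- Soundness holds for any amount of fuel. Completeness of the search is never proved: where it
  -- matters, the resulting list is checked.
  explore⊆⟨⟩ : ∀ n {S seen todo} → All ⟨ S ⟩ seen → All ⟨ S ⟩ todo → All ⟨ S ⟩ (explore n S seen todo)
  explore⊆⟨⟩ zero    seen todo = seen
  explore⊆⟨⟩ (suc n) seen []   = seen
  explore⊆⟨⟩ (suc n) {seen = L} seen (_∷_ {x} Sx todo) = visit⊆⟨⟩ (does (x ∈? L)) n seen Sx todo

  visit⊆⟨⟩ : ∀ b n {S x seen todo} → All ⟨ S ⟩ seen → ⟨ S ⟩ x → All ⟨ S ⟩ todo → All ⟨ S ⟩ (visit b n S x seen todo)
  visit⊆⟨⟩ true  n seen Sx todo = explore⊆⟨⟩ n seen todo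
  visit⊆⟨⟩ false n seen Sx todo =
    explore⊆⟨⟩ n (Sx ∷ seen) (All.++⁺ (All.map⁺ (All.tabulate λ s → mul Sx (gen s))) todo)

-- At most 120 elements are met, each pushing at most four more.
closure : List Elem → List Elem
closure S = explore 481 S [] (e ∷ [])

closure⊆⟨⟩ : ∀ S → All ⟨ S ⟩ (closure S)
closure⊆⟨⟩ S = explore⊆⟨⟩ 481 [] (one ∷ [])

-- The group G, enumerated and generated by the triple of the first model.

gens : Triple → List Elem
gens t = r₀ t ∷ r₁ t ∷ r₂ t ∷ []

allMaps : ∀ n → List (Vec (Fin 5) n)
allMaps zero    = [] ∷ []
allMaps (suc n) = cartesianProductWith _∷_ (allFin 5) (allMaps n)

∈-allMaps : ∀ {n} (p : Vec (Fin 5) n) → p ∈ allMaps n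
∈-allMaps []      = here refl
∈-allMaps (k ∷ p) = ∈-cartesianProductWith⁺ _∷_ (∈-allFin k) (∈-allMaps p)

G : List Elem
G = cartesianProduct (filter (λ p → T? (inA5ᵇ p)) (allMaps 5)) (false ∷ true ∷ [])

InG⇒∈G : ∀ x → InG x → x ∈ G
InG⇒∈G (p , s) x∈ = ∈-cartesianProduct⁺ (∈-filter⁺ (λ p → T? (inA5ᵇ p)) (∈-allMaps p) x∈) (bool s)
  where
  bool : ∀ s → s ∈ false ∷ true ∷ []
  bool false = here refl
  bool true  = there (here refl)

inG? : ∀ x → Dec (InG x)
inG? (p , _) = T? (inA5ᵇ p)

G⊆closure-M₁ : All (_∈ closure (gens (M zero))) G
G⊆closure-M₁ = decided (within? (closure (gens (M zero)))) refl
  where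
  -- The list is an argument so that one evaluation of the closure serves all membership tests.
  within? : ∀ L → Dec (All (_∈ L) G)
  within? L = all? (_∈? L) G

-- Serves as an induction principle for G: by `⟨⟩-least`, stability need only be checked at three
-- generators.
M₁-generates : ∀ x → InG x → ⟨ gens (M zero) ⟩ x
M₁-generates x x∈ = All.lookup (closure⊆⟨⟩ (gens (M zero))) (All.lookup G⊆closure-M₁ (InG⇒∈G x x∈))

G·gens-M₁ : All (λ x → All (λ s → InG (x · s)) (gens (M zero))) G
G·gens-M₁ = decided (all? (λ x → all? (λ s → inG? (x · s)) (gens (M zero))) G) refl

-- Induction on `y` as a word in the generators of the first model reduces closure of G to 120 · 3
-- checked products, without a theory of parity.
·-InG : ∀ x y → InG x → InG y → InG (x · y)
·-InG x y x∈ y∈ = ⟨⟩-least (λ y → InG (x · y)) (subst InG (sym (·-identityʳ x)) x∈)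
  (λ {y} {s} xy∈ s∈ → subst InG (·-assoc x y s) (All.lookup (All.lookup G·gens-M₁ (InG⇒∈G (x · y) xy∈)) s∈))
  (M₁-generates y y∈)

-- Relabelling the five points

conj : Elem → Elem → Elem → Elem
conj p p⁻¹ x = p⁻¹ · x · p

conj-e : ∀ {p p⁻¹} → p⁻¹ · p ≡ e → conj p p⁻¹ e ≡ e
conj-e {p} {p⁻¹} p⁻¹p≡e = trans (cong (_· p) (·-identityʳ p⁻¹)) p⁻¹p≡e

conj-· : ∀ {p p⁻¹} → p · p⁻¹ ≡ e → ∀ x y → conj p p⁻¹ (x · y) ≡ conj p p⁻¹ x · conj p p⁻¹ y
conj-· {p} {p⁻¹} pp⁻¹≡e x y = begin
  p⁻¹ · (x · y) · p                ≡⟨ cong (_· p) (·-assoc p⁻¹ x y) ⟨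
  p⁻¹ · x · y · p                  ≡⟨ ·-assoc (p⁻¹ · x) y p ⟩
  (p⁻¹ · x) · (y · p)              ≡⟨ cancel-middle (p⁻¹ · x) {p} {p⁻¹} (y · p) pp⁻¹≡e ⟨
  (p⁻¹ · x · p) · (p⁻¹ · (y · p))  ≡⟨ cong (p⁻¹ · x · p ·_) (·-assoc p⁻¹ y p) ⟨
  (p⁻¹ · x · p) · (p⁻¹ · y · p)    ∎

conj-mul : ∀ p p⁻¹ q q⁻¹ x → conj (p · q) (q⁻¹ · p⁻¹) x ≡ conj q q⁻¹ (conj p p⁻¹ x)
conj-mul p p⁻¹ q q⁻¹ x = begin
  q⁻¹ · p⁻¹ · x · (p · q)    ≡⟨ ·-assoc (q⁻¹ · p⁻¹ · x) p q ⟨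
  q⁻¹ · p⁻¹ · x · p · q      ≡⟨ cong (λ y → y · p · q) (·-assoc q⁻¹ p⁻¹ x) ⟩
  q⁻¹ · (p⁻¹ · x) · p · q    ≡⟨ cong (_· q) (·-assoc q⁻¹ (p⁻¹ · x) p) ⟩
  q⁻¹ · (p⁻¹ · x · p) · q    ∎

conj-inverse : ∀ {p p⁻¹} → p · p⁻¹ ≡ e → ∀ x → conj p⁻¹ p (conj p p⁻¹ x) ≡ x
conj-inverse {p} {p⁻¹} pp⁻¹≡e x = begin
  conj p⁻¹ p (conj p p⁻¹ x)       ≡⟨ conj-mul p p⁻¹ p⁻¹ p x ⟨
  conj (p · p⁻¹) (p · p⁻¹) x      ≡⟨ cong (λ y → conj y y x) pp⁻¹≡e ⟩
  e · x · e                       ≡⟨ ·-identityʳ (e · x) ⟩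
  e · x                           ≡⟨ ·-identityˡ x ⟩
  x                               ∎

-- `p` may be odd and thus lie outside G, so invariance of G under conjugation is recorded in both
-- directions. The inverse is explicit because `Elem` also contains maps that are not invertible.
record Relabelling (p p⁻¹ : Elem) : Set where
  field
    inverseʳ    : p · p⁻¹ ≡ e
    inverseˡ    : p⁻¹ · p ≡ e
    preserves   : ∀ x → InG x → InG (conj p p⁻¹ x)
    preserves⁻¹ : ∀ x → InG x → InG (conj p⁻¹ p x)
open Relabelling

-- With its second pair repeating the first, `dt i j i j` is the single transposition (i j).
-- Adjacent transpositions generate the symmetric group.
transpositions : List Elem
transpositions = map (λ (i , j) → dt i j i j , false) ((p1 , p2) ∷ (p2 , p3) ∷ (p3 , p4) ∷ (p4 , p5) ∷ [])

S₅ : List Elem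
S₅ = closure transpositions

transposition-checks : All (λ τ → τ · τ ≡ e × All (λ s → InG (conj τ τ s)) (gens (M zero))) transpositions
transposition-checks = decided
  (all? (λ τ → (τ · τ ≟ e) ×-dec all? (λ s → inG? (conj τ τ s)) (gens (M zero))) transpositions) refl

transposition-relabels : ∀ {τ} → τ ∈ transpositions → Relabelling τ τ
transposition-relabels {τ} τ∈ = record { inverseʳ = ττ≡e ; inverseˡ = ττ≡e ; preserves = pres ; preserves⁻¹ = pres }
  where
  ττ≡e = proj₁ (All.lookup transposition-checks τ∈)
  pres : ∀ x → InG x → InG (conj τ τ x)
  pres x x∈ = ⟨⟩-least (λ x → InG (conj τ τ x)) (subst InG (sym (conj-e {τ} {τ} ττ≡e)) _)
    (λ {x} {s} x∈ s∈ → subst InG (sym (conj-· {τ} {τ} ττ≡e x s))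
      (·-InG (conj τ τ x) (conj τ τ s) x∈ (All.lookup (proj₂ (All.lookup transposition-checks τ∈)) s∈)))
    (M₁-generates x x∈)

relabelling : ∀ {p} → ⟨ transpositions ⟩ p → ∃ (Relabelling p)
relabelling one = e , record
  { inverseʳ = refl ; inverseˡ = refl ; preserves = pres ; preserves⁻¹ = pres }
  where
  pres : ∀ x → InG x → InG (conj e e x)
  pres x = subst InG (sym (trans (·-identityʳ (e · x)) (·-identityˡ x)))
relabelling (gen {τ} τ∈) = τ , transposition-relabels τ∈
relabelling (mul {p} {q} p∈ q∈) with relabelling p∈ | relabelling q∈
... | p⁻¹ , ρ | q⁻¹ , κ = q⁻¹ · p⁻¹ , record
  { inverseʳ    = trans (cancel-middle p {q} {q⁻¹} p⁻¹ (inverseʳ κ)) (inverseʳ ρ)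
  ; inverseˡ    = trans (cancel-middle q⁻¹ {p⁻¹} {p} q (inverseˡ ρ)) (inverseˡ κ)
  ; preserves   = λ x x∈ → subst InG (sym (conj-mul p p⁻¹ q q⁻¹ x))
                    (preserves κ (conj p p⁻¹ x) (preserves ρ x x∈))
  ; preserves⁻¹ = λ x x∈ → subst InG (sym (conj-mul q⁻¹ q p⁻¹ p x))
                    (preserves⁻¹ ρ (conj q⁻¹ q x) (preserves⁻¹ κ x x∈))
  }

-- Conjugacy by `p` stated without the inverse, so that a search only compares products.
Intertwines : Elem → Triple → Triple → Set
Intertwines p t s = r₁ t · p ≡ p · r₁ s × r₀ t · p ≡ p · r₀ s × r₂ t · p ≡ p · r₂ s

intertwines-r : ∀ {p t s} → Intertwines p t s → ∀ i → r t i · p ≡ p · r s i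
intertwines-r (eq₁ , eq₀ , eq₂) zero             = eq₀
intertwines-r (eq₁ , eq₀ , eq₂) (suc zero)       = eq₁
intertwines-r (eq₁ , eq₀ , eq₂) (suc (suc zero)) = eq₂

intertwiner-iso : ∀ {p p⁻¹ t s} → Relabelling p p⁻¹ → Intertwines p t s → HypermapIso t s
intertwiner-iso {p} {p⁻¹} {t} {s} ρ tp≡ps = record
  { σ      = conj p p⁻¹
  ; σ-G    = preserves ρ
  ; σ-inj  = λ x y _ _ eq → begin
      x                          ≡⟨ conj-inverse {p} {p⁻¹} (inverseʳ ρ) x ⟨
      conj p⁻¹ p (conj p p⁻¹ x)  ≡⟨ cong (conj p⁻¹ p) eq ⟩
      conj p⁻¹ p (conj p p⁻¹ y)  ≡⟨ conj-inverse {p} {p⁻¹} (inverseʳ ρ) y ⟩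
      y                          ∎
  ; σ-surj = λ y y∈ → conj p⁻¹ p y , preserves⁻¹ ρ y y∈ , conj-inverse {p⁻¹} {p} (inverseˡ ρ) y
  ; σ-comm = λ i x _ → begin
      p⁻¹ · (x · r t i) · p    ≡⟨ cong (_· p) (·-assoc p⁻¹ x (r t i)) ⟨
      p⁻¹ · x · r t i · p      ≡⟨ ·-assoc (p⁻¹ · x) (r t i) p ⟩
      p⁻¹ · x · (r t i · p)    ≡⟨ cong (p⁻¹ · x ·_) (intertwines-r {p} {t} {s} tp≡ps i) ⟩
      p⁻¹ · x · (p · r s i)    ≡⟨ ·-assoc (p⁻¹ · x) p (r s i) ⟨
      p⁻¹ · x · p · r s i      ∎
  }

iso-trans : ∀ {t s u} → HypermapIso t s → HypermapIso s u → HypermapIso t u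
iso-trans f g = record
  { σ      = G.σ ∘ F.σ
  ; σ-G    = λ x x∈ → G.σ-G (F.σ x) (F.σ-G x x∈)
  ; σ-inj  = λ x y x∈ y∈ eq → F.σ-inj x y x∈ y∈ (G.σ-inj (F.σ x) (F.σ y) (F.σ-G x x∈) (F.σ-G y y∈) eq)
  ; σ-surj = λ z z∈ → let y , y∈ , eq = G.σ-surj z z∈ ; x , x∈ , eq′ = F.σ-surj y y∈ in x , x∈ , trans (cong G.σ eq′) eq
  ; σ-comm = λ i x x∈ → trans (cong G.σ (F.σ-comm i x x∈)) (G.σ-comm i (F.σ x) (F.σ-G x x∈))
  }
  where
  module F = HypermapIso f
  module G = HypermapIso g

-- Consequences of (1) and (2)

-- The form in which regularity is used, chosen to be carried along relabellings. The two-element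
-- list stands for ⟨r₂⟩ and makes membership decidable.
record Admissible (t : Triple) : Set where
  field
    involutive : ∀ i → InG (r t i) × Involution (r t i)
    generates  : ∀ x → InG x → ⟨ gens t ⟩ x
    separated  : ∀ {h k k′ h′} →
                 ⟨ r₁ t ∷ r₂ t ∷ [] ⟩ h → ⟨ r₀ t ∷ r₂ t ∷ [] ⟩ k →
                 ⟨ r₀ t ∷ r₂ t ∷ [] ⟩ k′ → ⟨ r₁ t ∷ r₂ t ∷ [] ⟩ h′ →
                 h · k ≡ k′ · h′ → h ∈ e ∷ r₂ t ∷ [] ⊎ k ∈ e ∷ r₂ t ∷ []
open Admissible

⟨involution⟩ : ∀ {s} → s · s ≡ e → ∀ {x} → ⟨ s ∷ [] ⟩ x → x ∈ e ∷ s ∷ []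
⟨involution⟩ {s} ss≡e = closed⊇⟨⟩
  (here refl , (there (here (·-identityˡ s)) ∷ []) ∷ (here ss≡e ∷ []) ∷ [])

admissible : ∀ {t} → RegularLinearHypermap t → Admissible t
admissible {t} (t⊆G , inv , _ , generate , H∩K , HK∩KH) = record
  { involutive = λ i → t⊆G i , inv i
  ; generates  = generate
  ; separated  = sep
  }
  where
  inv₀ = proj₂ (inv zero)
  inv₁ = proj₂ (inv (suc zero))
  inv₂ = proj₂ (inv (suc (suc zero)))
  -- By (2) the product lies in H or in K, hence k or h lies in H ∩ K, which is ⟨r₂⟩ by (1).
  sep : ∀ {h k k′ h′} → _ → _ → _ → _ → h · k ≡ k′ · h′ → h ∈ e ∷ r₂ t ∷ [] ⊎ k ∈ e ∷ r₂ t ∷ []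
  sep {h} {k} {k′} {h′} h∈H k∈K k′∈K h′∈H hk≡k′h′
    with proj₁ (HK∩KH (h · k)) ((h , k , h∈H , k∈K , refl) , (k′ , h′ , k′∈K , h′∈H , hk≡k′h′))
  ... | inj₁ hk∈H with h⁻¹ , h⁻¹∈H , _ , h⁻¹h ← ⟨⟩-inverse (inv₁ ∷ inv₂ ∷ []) h∈H =
    inj₂ (⟨involution⟩ inv₂ (proj₁ (H∩K k) (subst ⟨ _ ⟩ (inverse-cancel {h} {h⁻¹} h⁻¹h k) (mul h⁻¹∈H hk∈H) , k∈K)))
  ... | inj₂ hk∈K with k⁻¹ , k⁻¹∈K , kk⁻¹ , _ ← ⟨⟩-inverse (inv₀ ∷ inv₂ ∷ []) k∈K =
    inj₁ (⟨involution⟩ inv₂ (proj₁ (H∩K h) (h∈H , subst ⟨ _ ⟩ (inverse-cancelʳ {k} {k⁻¹} kk⁻¹ h) (mul hk∈K k⁻¹∈K))))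

conjugate : Elem → Elem → Triple → Triple
conjugate p p⁻¹ t = mkT (conj p p⁻¹ (r₀ t)) (conj p p⁻¹ (r₁ t)) (conj p p⁻¹ (r₂ t))

conj-intertwines : ∀ {p p⁻¹} → p · p⁻¹ ≡ e → ∀ x → x · p ≡ p · conj p p⁻¹ x
conj-intertwines {p} {p⁻¹} pp⁻¹≡e x = begin
  x · p                ≡⟨ inverse-cancel {p⁻¹} {p} pp⁻¹≡e (x · p) ⟨
  p · (p⁻¹ · (x · p))  ≡⟨ cong (p ·_) (·-assoc p⁻¹ x p) ⟨
  p · (p⁻¹ · x · p)    ∎

-- A coincidence for the conjugate triple is pulled back by the inverse conjugation `ψ`, settled
-- there by `separated`, and the resulting membership is pushed forward by `φ`.
conjugate-admissible : ∀ {p p⁻¹ t} → Relabelling p p⁻¹ → Admissible t → Admissible (conjugate p p⁻¹ t)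
conjugate-admissible {p} {p⁻¹} {t} ρ adm = record
  { involutive = inv
  ; generates  = λ x x∈ → subst ⟨ gens (conjugate p p⁻¹ t) ⟩ (φψ x)
      (⟨⟩-image φ (conj-e {p} {p⁻¹} (inverseˡ ρ)) (conj-· {p} {p⁻¹} (inverseʳ ρ))
        (gen (here refl) ∷ gen (there (here refl)) ∷ gen (there (there (here refl))) ∷ [])
        (generates adm (ψ x) (preserves⁻¹ ρ x x∈)))
  ; separated  = λ {h} {k} {k′} {h′} h∈ k∈ k′∈ h′∈ hk≡k′h′ →
      Sum.map (back h) (back k)
        (separated adm (ψ-image h∈) (ψ-image k∈) (ψ-image k′∈) (ψ-image h′∈)
          (trans (sym (ψ-· h k)) (trans (cong ψ hk≡k′h′) (ψ-· k′ h′))))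
  }
  where
  φ = conj p p⁻¹
  ψ = conj p⁻¹ p
  φψ = conj-inverse {p⁻¹} {p} (inverseˡ ρ)
  ψφ = conj-inverse {p} {p⁻¹} (inverseʳ ρ)
  ψ-· = conj-· {p⁻¹} {p} (inverseˡ ρ)
  inv : ∀ i → InG (r (conjugate p p⁻¹ t) i) × Involution (r (conjugate p p⁻¹ t) i)
  inv i = subst (λ x → InG x × Involution x) (φr i)
    (preserves ρ (r t i) (proj₁ (involutive adm i)) , φ-nontrivial , φ-involutive)
    where
    φr : ∀ i → φ (r t i) ≡ r (conjugate p p⁻¹ t) i
    φr zero             = refl
    φr (suc zero)       = refl
    φr (suc (suc zero)) = refl
    φ-nontrivial : φ (r t i) ≢ e
    φ-nontrivial eq = proj₁ (proj₂ (involutive adm i))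
      (trans (sym (ψφ (r t i))) (trans (cong ψ eq) (conj-e {p⁻¹} {p} (inverseʳ ρ))))
    φ-involutive : φ (r t i) · φ (r t i) ≡ e
    φ-involutive = trans (sym (conj-· {p} {p⁻¹} (inverseʳ ρ) (r t i) (r t i)))
      (trans (cong φ (proj₂ (proj₂ (involutive adm i)))) (conj-e {p} {p⁻¹} (inverseˡ ρ)))
  ψ-image : ∀ {x y z} → ⟨ φ x ∷ φ y ∷ [] ⟩ z → ⟨ x ∷ y ∷ [] ⟩ (ψ z)
  ψ-image {x} {y} = ⟨⟩-image ψ (conj-e {p⁻¹} {p} (inverseʳ ρ)) ψ-·
    (subst ⟨ _ ⟩ (sym (ψφ x)) (gen (here refl)) ∷ subst ⟨ _ ⟩ (sym (ψφ y)) (gen (there (here refl))) ∷ [])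
  back : ∀ x → ψ x ∈ e ∷ r₂ t ∷ [] → x ∈ e ∷ φ (r₂ t) ∷ []
  back x (here eq)         = here (trans (sym (φψ x)) (trans (cong φ eq) (conj-e {p} {p⁻¹} (inverseˡ ρ))))
  back x (there (here eq)) = there (here (trans (sym (φψ x)) (cong φ eq)))

-- Forbidden coincidences

involutions : List Elem
involutions = filter (λ x → ¬? (x ≟ e) ×-dec (x · x ≟ e)) G

involution∈ : ∀ {x} → InG x × Involution x → x ∈ involutions
involution∈ {x} (x∈ , inv) = ∈-filter⁺ (λ x → ¬? (x ≟ e) ×-dec (x · x ≟ e)) (InG⇒∈G x x∈) inv

-- Representatives of the three classes of involutions; the last one is a.
pivots : List Elem
pivots = (p1 ⦅ p2 ⦆ p3 ⦅ p4 ⦆) ∷ (p1 ⦅ p2 ⦆ p3 ⦅ p4 ⦆a) ∷ (proj₁ e , true) ∷ []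

conjugate-to-pivot : All (λ x → Any (λ p → Any (λ c → x · p ≡ p · c) pivots) S₅) involutions
conjugate-to-pivot = decided (check S₅) refl
  where
  check : ∀ ps → Dec (All (λ x → Any (λ p → Any (λ c → x · p ≡ p · c) pivots) ps) involutions)
  check ps = all? (λ x → any? (λ p → any? (λ c → x · p ≟ p · c) pivots) ps) involutions

-- For involutions x and y every element of the dihedral group ⟨x, y⟩ is such a word beginning with
-- x, so four lengths encode a coincidence.
alternating : ℕ → Elem → Elem → Elem
alternating zero    x y = e
alternating (suc n) x y = x · alternating n y x

alternating∈ : ∀ {S} n {x y} → ⟨ S ⟩ x → ⟨ S ⟩ y → ⟨ S ⟩ (alternating n x y)
alternating∈ zero    x∈ y∈ = one
alternating∈ (suc n) x∈ y∈ = mul x∈ (alternating∈ n y∈ x∈)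

Coincidence : Triple → ℕ × ℕ × ℕ × ℕ → Set
Coincidence t (l , m , m′ , l′) =
  h · k ≡ alternating m′ (r₀ t) (r₂ t) · alternating l′ (r₁ t) (r₂ t) ×
  h ∉ e ∷ r₂ t ∷ [] × k ∉ e ∷ r₂ t ∷ []
  where
  h = alternating l (r₁ t) (r₂ t)
  k = alternating m (r₀ t) (r₂ t)

coincidence? : ∀ t q → Dec (Coincidence t q)
coincidence? t (l , m , m′ , l′) = (_ ≟ _) ×-dec ¬? (_ ∈? _) ×-dec ¬? (_ ∈? _)

¬coincidence : ∀ {t} → Admissible t → ∀ q → ¬ Coincidence t q
¬coincidence adm (l , m , m′ , l′) (eq , h∉ , k∉) =
  [ h∉ , k∉ ]′ (separated adm (alternating∈ l x y) (alternating∈ m x y) (alternating∈ m′ x y) (alternating∈ l′ x y) eq)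
  where
  x : ∀ {x y} → ⟨ x ∷ y ∷ [] ⟩ x
  x = gen (here refl)
  y : ∀ {x y} → ⟨ x ∷ y ∷ [] ⟩ y
  y = gen (there (here refl))

-- Found by a computer search: every generating triple that violates (1) or (2) has one of these coincidences.
lengths : List (ℕ × ℕ × ℕ × ℕ)
lengths = (1 , 1 , 1 , 1) ∷ (3 , 1 , 1 , 3) ∷ (1 , 3 , 3 , 1) ∷ (5 , 1 , 1 , 5) ∷ (3 , 3 , 3 , 3) ∷
          (1 , 1 , 3 , 1) ∷ (1 , 1 , 7 , 1) ∷ (5 , 1 , 3 , 5) ∷ (1 , 9 , 10 , 2) ∷ (9 , 5 , 6 , 10) ∷ []

-- A certificate that the triple generates too little. Testing the three generators of the first
-- model is enough, since a subgroup containing them contains G.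
Misses : Triple → List Elem → Set
Misses t L = Closed (gens t) L × Any (_∉ L) (gens (M zero))

misses? : ∀ t L → Dec (Misses t L)
misses? t L = closed? (gens t) L ×-dec any? (λ x → ¬? (x ∈? L)) (gens (M zero))

gens-M₁⊆G : All InG (gens (M zero))
gens-M₁⊆G = _ ∷ _ ∷ _ ∷ []

¬misses : ∀ {t} → Admissible t → ∀ L → ¬ Misses t L
¬misses adm L (closed , missed) with g , g∈ , g∉ ← find missed =
  g∉ (closed⊇⟨⟩ closed (generates adm g (All.lookup gens-M₁⊆G g∈)))

-- Classification of the admissible triples.

intertwines? : ∀ p t s → Dec (Intertwines p t s)
intertwines? p t s = (_ ≟ _) ×-dec (_ ≟ _) ×-dec (_ ≟ _)

matches? : ∀ c (pi : Elem × Fin 19) → Dec (c · proj₁ pi ≡ proj₁ pi · r₁ (M (proj₂ pi)))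
matches? c (p , i) = c · p ≟ p · r₁ (M i)

-- Depends on the pivot only, so the filtering precedes the search over `r₀` and `r₂`.
candidates : List Elem → Elem → List (Elem × Fin 19)
candidates ps c = filter (matches? c) (cartesianProduct ps (allFin 19))

candidates⊆ : ∀ ps c → All ((_∈ ps) ∘ proj₁) (candidates ps c)
candidates⊆ ps c = All.tabulate λ pi∈ →
  proj₁ (∈-cartesianProduct⁻ ps (allFin 19) (proj₁ (∈-filter⁻ (matches? c) {xs = cartesianProduct ps (allFin 19)} pi∈)))

data Classified (cs : List (Elem × Fin 19)) (t : Triple) : Set where
  coincident : Any (Coincidence t) lengths → Classified cs t
  isomorphic : Any (λ (p , i) → Intertwines p t (M i)) cs → Classified cs t
  degenerate : Misses t (closure (gens t)) → Classified cs t

-- The disjunction stops at the first success, so the costly closure is computed only for triples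
-- that the other two cases leave open.
classified? : ∀ cs t → Dec (Classified cs t)
classified? cs t = map′ [ coincident , [ isomorphic , degenerate ]′ ]′ split
  (any? (coincidence? t) lengths ⊎-dec
   any? (λ (p , i) → intertwines? p t (M i)) cs ⊎-dec
   misses? t (closure (gens t)))
  where
  split : Classified cs t → _ ⊎ _ ⊎ _
  split (coincident q) = inj₁ q
  split (isomorphic q) = inj₂ (inj₁ q)
  split (degenerate q) = inj₂ (inj₂ q)

-- Boolean conjunction is used because, unlike all?, it lets the evidence for one triple be discarded before the next one is examined.
classifies : Elem → List (Elem × Fin 19) → List Elem → Bool
classifies c cs I = all (λ x → all (λ y → does (classified? cs (mkT x c y))) I) I

all-sound : ∀ {A : Set} {P : A → Set} (P? : ∀ x → Dec (P x)) xs → T (all (does ∘ P?) xs) → All P xs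
all-sound P? xs ok = All.map (λ {x} → decided (P? x) ∘ Equivalence.to Bool.T-≡) (All.all⁺ (does ∘ P?) xs ok)

classifies-sound : ∀ c cs I → classifies c cs I ≡ true → ∀ {x y} → x ∈ I → y ∈ I → Classified cs (mkT x c y)
classifies-sound c cs I ok {x} x∈ = All.lookup (all-sound (λ y → classified? cs (mkT x c y)) I
  (All.lookup (All.all⁺ (λ x → all (λ y → does (classified? cs (mkT x c y))) I) I (Equivalence.from Bool.T-≡ ok)) x∈))

Decisive : Elem → Set
Decisive c = classifies c (candidates S₅ c) involutions ≡ true

pivots-decisive : All Decisive pivots
-- G has 15 + 15 + 1 = 31 involutions, so each `refl` examines 31 · 31 pairs of `r₀` and `r₂`.
pivots-decisive = refl ∷ refl ∷ refl ∷ []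

identify : ∀ {cs t} → All ((_∈ S₅) ∘ proj₁) cs → Admissible t → Classified cs t → Σ (Fin 19) λ i → HypermapIso t (M i)
identify cs⊆ adm (coincident coincidence) =
  let q , _ , cq = find coincidence in contradiction cq (¬coincidence adm q)
identify cs⊆ adm (isomorphic isModel) =
  let (p , i) , pi∈ , tp≡pM = find isModel
      p⁻¹ , ρ = relabelling (All.lookup (closure⊆⟨⟩ transpositions) (All.lookup cs⊆ pi∈))
  in i , intertwiner-iso ρ tp≡pM
identify {t = t} cs⊆ adm (degenerate misses) = contradiction misses (¬misses adm (closure (gens t)))

classify-pivoted : ∀ {t c} → Decisive c → r₁ t ≡ c → Admissible t → Σ (Fin 19) λ i → HypermapIso t (M i)
-- Eta for `Triple` identifies `mkT (r₀ t) (r₁ t) (r₂ t)` with `t`.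
classify-pivoted {t} {c} decisive refl adm = identify (candidates⊆ S₅ c) adm
  (classifies-sound c (candidates S₅ c) involutions decisive {r₀ t} {r₂ t}
    (involution∈ (involutive adm zero)) (involution∈ (involutive adm (suc (suc zero)))))

classify-conjugate : ∀ {t p p⁻¹ c} → Relabelling p p⁻¹ → Admissible t → Decisive c → r₁ t · p ≡ p · c →
                     Σ (Fin 19) λ i → HypermapIso t (M i)
classify-conjugate {t} {p} {p⁻¹} {c} ρ adm decisive r₁p≡pc =
  proj₁ classified , iso-trans (intertwiner-iso ρ (intertwine (r₁ t) , intertwine (r₀ t) , intertwine (r₂ t))) (proj₂ classified)
  where
  intertwine : ∀ x → x · p ≡ p · conj p p⁻¹ x
  intertwine = conj-intertwines {p} {p⁻¹} (inverseʳ ρ)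
  r₁-conj : conj p p⁻¹ (r₁ t) ≡ c
  r₁-conj = begin
    p⁻¹ · r₁ t · p    ≡⟨ ·-assoc p⁻¹ (r₁ t) p ⟩
    p⁻¹ · (r₁ t · p)  ≡⟨ cong (p⁻¹ ·_) r₁p≡pc ⟩
    p⁻¹ · (p · c)     ≡⟨ inverse-cancel {p} {p⁻¹} (inverseˡ ρ) c ⟩
    c                 ∎
  classified : Σ (Fin 19) λ i → HypermapIso (conjugate p p⁻¹ t) (M i)
  classified = classify-pivoted {conjugate p p⁻¹ t} {c} decisive r₁-conj (conjugate-admissible ρ adm)

classify : ∀ t → RegularLinearHypermap t → Σ (Fin 19) λ i → HypermapIso t (M i)
classify t reg =
  let adm = admissible reg
      p , p∈ , conjugates = find (All.lookup conjugate-to-pivot (involution∈ (involutive adm (suc zero))))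
      c , c∈ , r₁p≡pc     = find conjugates
      p⁻¹ , ρ             = relabelling (All.lookup (closure⊆⟨⟩ transpositions) p∈)
  in classify-conjugate {t} {p} {p⁻¹} {c} ρ adm (All.lookup {P = Decisive} pivots-decisive c∈) r₁p≡pc

-- The nineteen models

Checks : Triple → (H K L : List Elem) → Set
Checks t H K L =
  (∀ i → InG (r t i) × Involution (r t i)) ×
  (r₀ t ≢ r₁ t × r₀ t ≢ r₂ t × r₁ t ≢ r₂ t) ×
  All (_∈ L) (gens (M zero)) ×
  Closed (r₁ t ∷ r₂ t ∷ []) H × Closed (r₀ t ∷ r₂ t ∷ []) K ×
  All (λ x → x ∈ K → x ∈ e ∷ r₂ t ∷ []) H ×
  All (λ h → All (λ k → h · k ∈ cartesianProductWith _·_ K H → h · k ∈ H ⊎ h · k ∈ K) K) H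

checks? : ∀ t H K L → Dec (Checks t H K L)
checks? t H K L =
  Fin.all? (λ i → inG? (r t i) ×-dec ¬? (r t i ≟ e) ×-dec (r t i · r t i ≟ e)) ×-dec
  (¬? (r₀ t ≟ r₁ t) ×-dec ¬? (r₀ t ≟ r₂ t) ×-dec ¬? (r₁ t ≟ r₂ t)) ×-dec
  all? (_∈? L) (gens (M zero)) ×-dec
  closed? (r₁ t ∷ r₂ t ∷ []) H ×-dec closed? (r₀ t ∷ r₂ t ∷ []) K ×-dec
  all? (λ x → (x ∈? K) →-dec (x ∈? (e ∷ r₂ t ∷ []))) H ×-dec
  all? (λ h → all? (λ k → (h · k ∈? cartesianProductWith _·_ K H) →-dec ((h · k ∈? H) ⊎-dec (h · k ∈? K))) K) H

Verified : Triple → Set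
Verified t = Checks t (closure (r₁ t ∷ r₂ t ∷ [])) (closure (r₀ t ∷ r₂ t ∷ [])) (closure (gens t))

verified? : ∀ t → Dec (Verified t)
verified? t = checks? t (closure (r₁ t ∷ r₂ t ∷ [])) (closure (r₀ t ∷ r₂ t ∷ [])) (closure (gens t))

-- `LH` and `LK` are bounded on both sides, hence list H and K exactly, and the finite checks become
-- (1) and (2). For `L` the lower bound suffices: the triple generates the generators of the first
-- model, hence G.
checks⇒regular : ∀ {t LH LK L} → All ⟨ r₁ t ∷ r₂ t ∷ [] ⟩ LH → All ⟨ r₀ t ∷ r₂ t ∷ [] ⟩ LK → All ⟨ gens t ⟩ L →
                 Checks t LH LK L → RegularLinearHypermap t
checks⇒regular {t} {LH} {LK} LH⊆H LK⊆K L⊆ (inv , distinct , M₁⊆L , H-closed , K-closed , H∩K , HK∩KH) =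
  proj₁ ∘ inv , proj₂ ∘ inv , distinct ,
  (λ x x∈ → ⟨⟩-mono (All.map (All.lookup L⊆) M₁⊆L) (M₁-generates x x∈)) ,
  (λ x → (λ (Hx , Kx) → r₂-generates (All.lookup H∩K (closed⊇⟨⟩ H-closed Hx) (closed⊇⟨⟩ K-closed Kx))) ,
         λ r₂x → ⟨⟩-mono (gen (there (here refl)) ∷ []) r₂x , ⟨⟩-mono (gen (there (here refl)) ∷ []) r₂x) ,
  λ x → products x ,
        [ (λ Hx → (x , e , Hx , one , sym (·-identityʳ x)) , (e , x , one , Hx , sym (·-identityˡ x)))
        , (λ Kx → (e , x , one , Kx , sym (·-identityˡ x)) , (x , e , Kx , one , sym (·-identityʳ x))) ]′
  where
  H K : Elem → Set
  H = ⟨ r₁ t ∷ r₂ t ∷ [] ⟩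
  K = ⟨ r₀ t ∷ r₂ t ∷ [] ⟩
  r₂-generates : ∀ {x} → x ∈ e ∷ r₂ t ∷ [] → ⟨ r₂ t ∷ [] ⟩ x
  r₂-generates (here refl) = one
  r₂-generates (there x∈)  = gen x∈
  products : ∀ x → (H ⋆ K) x × (K ⋆ H) x → H x ⊎ K x
  products x ((h , k , Hh , Kk , refl) , (k′ , h′ , Kk′ , Hh′ , eq)) =
    Sum.map (All.lookup LH⊆H) (All.lookup LK⊆K)
      (All.lookup (All.lookup HK∩KH (closed⊇⟨⟩ H-closed Hh)) (closed⊇⟨⟩ K-closed Kk)
        (subst (_∈ cartesianProductWith _·_ LK LH) (sym eq)
          (∈-cartesianProductWith⁺ _·_ (closed⊇⟨⟩ K-closed Kk′) (closed⊇⟨⟩ H-closed Hh′))))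

verified⇒regular : ∀ t → Verified t → RegularLinearHypermap t
verified⇒regular t = checks⇒regular (closure⊆⟨⟩ _) (closure⊆⟨⟩ _) (closure⊆⟨⟩ _)

models-verified : ∀ i → Verified (M i)
models-verified = decided (Fin.all? (verified? ∘ M)) refl

-- Relators distinguish the models

-- The flag reached from `x` by the walk `w`. Isomorphisms commute with walks, while they are not
-- assumed to be multiplicative.
run : Triple → Elem → List (Fin 3) → Elem
run t x []      = x
run t x (i ∷ w) = run t (x · r t i) w

-- Left translations commute with the right action, so a walk that closes up at one flag closes up
-- at all.
run-translate : ∀ t x y w → run t (x · y) w ≡ x · run t y w
run-translate t x y []      = refl
run-translate t x y (i ∷ w) = trans (cong (λ z → run t z w) (·-assoc x y (r t i))) (run-translate t x (y · r t i) w)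

run-from : ∀ t x w → run t x w ≡ x · run t e w
run-from t x w = trans (cong (λ y → run t y w) (sym (·-identityʳ x))) (run-translate t x e w)

run-InG : ∀ t → (∀ i → InG (r t i)) → ∀ x → InG x → ∀ w → InG (run t x w)
run-InG t t⊆G x x∈ []      = x∈
run-InG t t⊆G x x∈ (i ∷ w) = run-InG t t⊆G (x · r t i) (·-InG x (r t i) x∈ (t⊆G i)) w

module _ {t s} (t⊆G : ∀ i → InG (r t i)) (iso : HypermapIso t s) where
  open HypermapIso iso

  σ-run : ∀ x → InG x → ∀ w → σ (run t x w) ≡ run s (σ x) w
  σ-run x x∈ []      = refl
  σ-run x x∈ (i ∷ w) = trans (σ-run (x · r t i) (·-InG x (r t i) x∈ (t⊆G i)) w)
                             (cong (λ y → run s y w) (σ-comm i x x∈))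

  -- `σ` need not fix `e`, so the walk is started at a preimage of `e`, where it closes up by
  -- translation.
  relator-preserved : ∀ w → run t e w ≡ e → run s e w ≡ e
  relator-preserved w w≡e with x , x∈ , σx≡e ← σ-surj e _ = begin
    run s e w      ≡⟨ cong (λ y → run s y w) σx≡e ⟨
    run s (σ x) w  ≡⟨ σ-run x x∈ w ⟨
    σ (run t x w)  ≡⟨ cong σ (trans (run-from t x w) (trans (cong (x ·_) w≡e) (·-identityʳ x))) ⟩
    σ x            ≡⟨ σx≡e ⟩
    e              ∎

  -- The image of the walk starts at `σ e` and closes up there by translation; injectivity of `σ` on
  -- G brings this back to `e`.
  relator-reflected : ∀ w → run s e w ≡ e → run t e w ≡ e
  relator-reflected w w≡e = σ-inj (run t e w) e (run-InG t t⊆G e _ w) _ (begin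
    σ (run t e w)    ≡⟨ σ-run e _ w ⟩
    run s (σ e) w    ≡⟨ run-from s (σ e) w ⟩
    σ e · run s e w  ≡⟨ cong (σ e ·_) w≡e ⟩
    σ e · e          ≡⟨ ·-identityʳ (σ e) ⟩
    σ e              ∎)

_^_ : List (Fin 3) → ℕ → List (Fin 3)
w ^ n = concat (replicate n w)

-- Words found by a computer search.
relators : List (List (Fin 3))
relators = (# 0 ∷ # 2 ∷ []) ^ 2 ∷ (# 0 ∷ # 1 ∷ []) ^ 3 ∷ (# 1 ∷ # 2 ∷ []) ^ 3 ∷ (# 0 ∷ # 1 ∷ []) ^ 5 ∷
           (# 0 ∷ # 1 ∷ # 2 ∷ []) ^ 5 ∷ (# 0 ∷ # 1 ∷ # 2 ∷ # 1 ∷ []) ^ 6 ∷ (# 0 ∷ # 1 ∷ # 2 ∷ []) ^ 3 ∷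
           (# 0 ∷ # 1 ∷ []) ^ 6 ∷ []

-- Since the relators are powers, each entry tells whether the order of a word in the generators
-- divides a given exponent.
signature : Triple → List Bool
signature t = map (λ w → does (run t e w ≟ e)) relators

signature-cong : ∀ {t s} → (∀ i → InG (r t i)) → HypermapIso t s → signature t ≡ signature s
signature-cong {t} {s} t⊆G iso = List.map-cong
  (λ w → does-⇔ (mk⇔ (relator-preserved t⊆G iso w) (relator-reflected t⊆G iso w)) (run t e w ≟ e) (run s e w ≟ e))
  relators

signature-injective : ∀ i j → signature (M i) ≡ signature (M j) → i ≡ j
signature-injective = decided
  (Fin.all? λ i → Fin.all? λ j → List.≡-dec Bool._≟_ (signature (M i)) (signature (M j)) →-dec (i Fin.≟ j)) refl

theorem3p13 : (∀ (t : Triple) → RegularLinearHypermap t → Σ (Fin 19) λ i → HypermapIso t (M i))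
    × (∀ (i : Fin 19) → RegularLinearHypermap (M i))
    × (∀ (i j : Fin 19) → HypermapIso (M i) (M j) → i ≡ j)
theorem3p13 =
  classify ,
  (λ i → verified⇒regular (M i) (models-verified i)) ,
  λ i j iso → signature-injective i j (signature-cong (proj₁ ∘ proj₁ (models-verified i)) iso)
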